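{- Let $V$ be a finite set and let $A$ be a real symmetric matrix indexed by $V$. If $A$ has no self-contained pair of weighted chordless walks (i.e., no two weighted chordless walks $W_1,W_2$ in $A$ with $V(W_1)\cup V(W_2)=I(W_1)\cup I(W_2)$), then $A$ has a simplicial vertex.
   Context: An element $v\in V$ is simplicial in $A$ if $A_{yz}\ge\min\{A_{vy},A_{vz}\}$ for all distinct $y,z\in V\setminus\{v\}$. A walk is an ordered sequence $W=(v_0,\dots,v_p)$ ($p\ge1$) of elements of $V$; $V(W)=\{v_0,\dots,v_p\}$, $I(W)=\{v_1,\dots,v_{p-1}\}$. $W$ is weighted chordless in $A$ if $A_{v_{i-1}v_{i+1}}<\min\{A_{v_{i-1}v_i},A_{v_{i+1}v_i}\}$ for all $1\le i\le p-1$. -}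

module Defs where

open import Data.Fin.Base using (Fin; suc; inject₁)
open import Data.Nat.Base using (ℕ; suc)
open import Data.Product.Base using (_×_; _,_; ∃; ∃₂; proj₁; proj₂)
open import Data.Rational.Base as ℚ using (ℚ)
import Data.Rational.Properties as ℚ
open import Data.Sum.Base using (_⊎_; inj₁; inj₂)
open import Function.Bundles using (_⇔_; mk⇔; Equivalence)
open import Level using (0ℓ)
open import Relation.Binary.Definitions using (tri<; tri≈; tri>)
open import Relation.Binary.PropositionalEquality.Core using (_≡_; _≢_; refl)
open import Relation.Nullary.Negation.Core using (¬_)
open import Relation.Unary using (Pred; _∈_; _⊆_; _≐_; _∩_; _∪_; Satisfiable)

-- Two-sided Dedekind cuts: q ∈ lower x means q < x, q ∈ upper x means x < q.

record ℝ : Set₁ where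
  field
    lower upper   : Pred ℚ 0ℓ
    lower-inhab   : Satisfiable lower
    upper-inhab   : Satisfiable upper
    lower-rounded : ∀ q → q ∈ lower ⇔ (∃ λ r → q ℚ.< r × r ∈ lower)
    upper-rounded : ∀ q → q ∈ upper ⇔ (∃ λ r → r ℚ.< q × r ∈ upper)
    disjoint      : ∀ q → ¬ (q ∈ lower × q ∈ upper)
    located       : ∀ {q r} → q ℚ.< r → q ∈ lower ⊎ r ∈ upper

open ℝ public

infix 4 _≃_ _≤_ _≥_ _<_

_≃_ : ℝ → ℝ → Set
x ≃ y = (lower x ≐ lower y) × (upper x ≐ upper y)

_≤_ : ℝ → ℝ → Set
x ≤ y = lower x ⊆ lower y

_≥_ : ℝ → ℝ → Set
x ≥ y = y ≤ x

_<_ : ℝ → ℝ → Set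
x < y = ∃ λ q → q ∈ upper x × q ∈ lower y

private
  lower-down : ∀ x {q r} → q ℚ.< r → r ∈ lower x → q ∈ lower x
  lower-down x {q} {r} q<r r∈ = Equivalence.from (lower-rounded x q) (r , q<r , r∈)

  lower-up : ∀ x {q} → q ∈ lower x → ∃ λ r → q ℚ.< r × r ∈ lower x
  lower-up x {q} = Equivalence.to (lower-rounded x q)

infixl 7 _⊓_

_⊓_ : ℝ → ℝ → ℝ
x ⊓ y = record
  { lower         = lower x ∩ lower y
  ; upper         = upper x ∪ upper y
  ; lower-inhab   = inhab (lower-inhab x) (lower-inhab y)
  ; upper-inhab   = proj₁ (upper-inhab x) , inj₁ (proj₂ (upper-inhab x))
  ; lower-rounded = λ q → mk⇔
      (λ (a , b) → common (lower-up x a) (lower-up y b))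
      (λ (r , q<r , a , b) → lower-down x q<r a , lower-down y q<r b)
  ; upper-rounded = λ q → mk⇔
      (λ { (inj₁ a) → let r , r<q , a′ = Equivalence.to (upper-rounded x q) a in r , r<q , inj₁ a′
         ; (inj₂ b) → let r , r<q , b′ = Equivalence.to (upper-rounded y q) b in r , r<q , inj₂ b′ })
      (λ { (r , r<q , inj₁ a) → inj₁ (Equivalence.from (upper-rounded x q) (r , r<q , a))
         ; (r , r<q , inj₂ b) → inj₂ (Equivalence.from (upper-rounded y q) (r , r<q , b)) })
  ; disjoint      = λ { q ((a , b) , inj₁ u) → disjoint x q (a , u)
                      ; q ((a , b) , inj₂ u) → disjoint y q (b , u) }
  ; located       = λ q<r → loc (located x q<r) (located y q<r)
  }
  where
  inhab : Satisfiable (lower x) → Satisfiable (lower y) → Satisfiable (lower x ∩ lower y)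
  inhab (q , a) (r , b) with ℚ.<-cmp q r
  ... | tri< q<r _ _  = q , a , lower-down y q<r b
  ... | tri≈ _ refl _ = q , a , b
  ... | tri> _ _ r<q  = r , lower-down x r<q a , b

  common : ∀ {q} → (∃ λ r → q ℚ.< r × r ∈ lower x) → (∃ λ r → q ℚ.< r × r ∈ lower y) →
           ∃ λ r → q ℚ.< r × r ∈ lower x ∩ lower y
  common (r , q<r , a) (s , q<s , b) with ℚ.<-cmp r s
  ... | tri< r<s _ _  = r , q<r , a , lower-down y r<s b
  ... | tri≈ _ refl _ = r , q<r , a , b
  ... | tri> _ _ s<r  = s , q<s , lower-down x s<r a , b

  loc : ∀ {q r} → q ∈ lower x ⊎ r ∈ upper x → q ∈ lower y ⊎ r ∈ upper y →
        q ∈ lower x ∩ lower y ⊎ r ∈ upper x ∪ upper y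
  loc (inj₁ a) (inj₁ b) = inj₁ (a , b)
  loc (inj₂ u) _        = inj₂ (inj₁ u)
  loc (inj₁ _) (inj₂ u) = inj₂ (inj₂ u)

Matrix : Set → Set₁
Matrix V = V → V → ℝ

module _ {V : Set} where

  Symmetric : Matrix V → Set
  Symmetric A = ∀ x y → A x y ≃ A y x

  Simplicial : Matrix V → V → Set
  Simplicial A v = ∀ y z → y ≢ v → z ≢ v → y ≢ z → A y z ≥ A v y ⊓ A v z

-- A walk (v₀, …, vₚ) with p = suc inner ≥ 1.  Repetitions are allowed.

record Walk (V : Set) : Set where
  constructor walk
  field
    inner  : ℕ
    vertex : Fin (suc (suc inner)) → V

  -- For j : Fin inner these are v_{i-1}, v_i, v_{i+1} with i = toℕ j + 1,
  -- so i runs over 1, …, p-1.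

  before at after : Fin inner → V
  before j = vertex (inject₁ (inject₁ j))
  at     j = vertex (suc (inject₁ j))
  after  j = vertex (suc (suc j))

  vertices : Pred V 0ℓ
  vertices x = ∃ λ i → vertex i ≡ x

  interior : Pred V 0ℓ
  interior x = ∃ λ j → at j ≡ x

module _ {V : Set} where

  open Walk

  WeightedChordless : Matrix V → Walk V → Set
  WeightedChordless A W = ∀ j →
    A (before W j) (after W j) < A (before W j) (at W j) ⊓ A (after W j) (at W j)

  SelfContained : Walk V → Walk V → Set
  SelfContained W₁ W₂ = vertices W₁ ∪ vertices W₂ ≐ interior W₁ ∪ interior W₂

  HasSelfContainedPair : Matrix V → Set
  HasSelfContainedPair A = ∃₂ λ W₁ W₂ →
    WeightedChordless A W₁ × WeightedChordless A W₂ × SelfContained W₁ W₂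

{-# OPTIONS --safe #-}
module Submission where

-- Call v obstructed in K if some x, z ∈ K make (x , v , z) chordless; without self-contained
-- pairs we show, by induction on |K|, that if every vertex of a nonempty C ⊆ K is obstructed
-- in K then some chordless walk has its interior in C and both ends in K ∖ C.  For K = C = V
-- this is absurd, so some vertex is not obstructed, that is, simplicial.
--
-- Let A p q be the least off-diagonal entry on K and G the graph of the larger entries; every
-- induced path of G is a chordless walk.  If each c ∈ C is joined in G to all of K, then
-- (p , c , q) is such a walk.  Otherwise some c ∈ C is separated from some x by a set Z with
-- components S ∋ c and S′ ∋ x of G − Z such that N(S) = N(S′) = Z.  Induction on
-- (S ∪ Z , S ∩ C) gives a walk whose ends in Z can be prolonged by induced paths of G to any
-- prescribed vertex of S′.  If S′ meets K ∖ C, prolong into it and truncate; likewise with S and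
-- S′ exchanged.  If S and S′ both lie in C, the two walks, each prolonged to an interior vertex
-- of the other, form a self-contained pair.

open import Defs
open import Axiom.ExcludedMiddle using (ExcludedMiddle)
open import Data.Empty using (⊥-elim)
open import Data.Fin.Base using (Fin; zero; suc; inject₁)
open import Data.List.Base using (List; []; _∷_; length; filter; map; allFin; cartesianProduct)
open import Data.List.Membership.Propositional using (lose) renaming (_∈_ to _∈ˡ_)
open import Data.List.Membership.Propositional.Properties
  using (∈-filter⁺; ∈-map⁺; ∈-allFin; ∈-cartesianProduct⁺)
open import Data.List.Properties using (filter-notAll)
open import Data.List.Relation.Unary.All as All using (All; []; _∷_)
open import Data.List.Relation.Unary.Any using (Any; here; there)
open import Data.Nat.Base as ℕ using (ℕ; suc; s≤s)
import Data.Nat.Properties as ℕ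
open import Data.Product.Base using (_×_; _,_; ∃; ∃₂; proj₁; proj₂)
import Data.Rational.Base as ℚ
import Data.Rational.Properties as ℚ
open import Data.Sum.Base using (_⊎_; inj₁; inj₂; [_,_]′)
open import Data.Unit.Base using (tt)
open import Function.Base using (_∘_; id)
open import Function.Bundles using (_↔_; Inverse; Equivalence)
open import Level using (0ℓ)
open import Relation.Binary.Construct.Closure.ReflexiveTransitive as Star
  using (Star; ε; _◅_; _◅◅_)
open import Relation.Binary.Definitions using (tri<; tri≈; tri>)
open import Relation.Binary.PropositionalEquality.Core using (_≡_; _≢_; refl; sym; trans; subst; ≢-sym)
open import Relation.Nullary.Decidable.Core using (Dec; yes; no; decidable-stable)
open import Relation.Nullary.Negation.Core using (¬_; contradiction)
open import Relation.Unary using (Pred; _∈_; _∉_; _⊆_; _∪_; _∩_; U)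

-- Order on Dedekind cuts

<-irrefl : ∀ x → ¬ x < x
<-irrefl x (q , u , l) = disjoint x q (l , u)

<-trans : ∀ x y z → x < y → y < z → x < z
<-trans x y z (q , u , l) (r , u′ , l′) with ℚ.<-cmp q r
... | tri< q<r _ _  = r , Equivalence.from (upper-rounded x r) (q , q<r , u) , l′
... | tri≈ _ refl _ = q , u , l′
... | tri> _ _ r<q  = ⊥-elim (disjoint y q (l , Equivalence.from (upper-rounded y q) (r , r<q , u′)))

-- Roundedness opens a rational gap `q < r` below `z`, and `y` is located with respect to it.
<-cotrans : ∀ x y z → x < z → x < y ⊎ y < z
<-cotrans x y z (q , u , l) with Equivalence.to (lower-rounded z q) l
... | r , q<r , l′ with located y q<r
...   | inj₁ a = inj₁ (q , u , a)
...   | inj₂ b = inj₂ (r , b , l′)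

<-respʳ-≃ : ∀ x y z → y ≃ z → x < y → x < z
<-respʳ-≃ _ _ _ ((f , _) , _) (q , u , l) = q , u , f l

<-⊓ : ∀ x y z → x < y → x < z → x < y ⊓ z
<-⊓ x y z (q , u , l) (r , u′ , l′) with ℚ.<-cmp q r
... | tri< q<r _ _  = q , u , l , Equivalence.from (lower-rounded z q) (r , q<r , l′)
... | tri≈ _ refl _ = q , u , l , l′
... | tri> _ _ r<q  = r , u′ , Equivalence.from (lower-rounded y r) (q , r<q , l) , l′

-- Classical comparison and minima

module Classical (em : ExcludedMiddle 0ℓ) where

  ≰⇒> : ∀ x y → ¬ x ≤ y → y < x
  ≰⇒> x y x≰y with em {∃ λ q → q ∈ lower x × q ∉ lower y}
  ... | no none = contradiction (λ {q} l → decidable-stable em (λ l′ → none (q , l , l′))) x≰y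
  ... | yes (q , l , ¬l) with Equivalence.to (lower-rounded x q) l
  ...   | r , q<r , l′ with located y q<r
  ...     | inj₁ a = contradiction a ¬l
  ...     | inj₂ b = r , b , l′

  least : ∀ {X : Set} (f : X → ℝ) {P : Pred X 0ℓ} xs → Any P xs →
          ∃ λ m → m ∈ P × All (λ x → x ∈ P → ¬ f x < f m) xs
  least f {P} (x ∷ xs) any with em {Any P xs}
  least f (x ∷ xs) (here px)   | no none =
    x , px , (λ _ → <-irrefl (f x)) ∷
             All.tabulate (λ y∈xs py → contradiction (lose y∈xs py) none)
  least f (x ∷ xs) (there any) | no none = contradiction any none
  least f {P} (x ∷ xs) _       | yes any with least f xs any
  ... | m , pm , m≤ with em {x ∈ P × f x < f m}
  ...   | yes (px , x<m) =
    x , px , (λ _ → <-irrefl (f x)) ∷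
             All.map (λ {y} m≤y py y<x → m≤y py (<-trans (f y) (f x) (f m) y<x x<m)) m≤
  ...   | no x≮m = m , pm , (λ px x<m → x≮m (px , x<m)) ∷ m≤

  -- Chordless paths and crossings

  module _ {V : Set} (A : Matrix V) (A-sym : Symmetric A) where

    -- Distinct ends are recorded because minimality of the threshold concerns off-diagonal entries
    -- only.
    Induced : V → V → V → Set
    Induced x y z = x ≢ z × A x z < A x y ⊓ A z y

    Induced-sym : ∀ {x y z} → Induced x y z → Induced z y x
    Induced-sym {x} {y} {z} (x≢z , q , u , l , l′) =
      ≢-sym x≢z , q , proj₁ (proj₂ (A-sym x z)) u , l′ , l

    Obstructed : Pred V 0ℓ → Pred V 0ℓ
    Obstructed K v = ∃₂ λ x z → x ∈ K × z ∈ K × Induced x v z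

    -- A chordless walk that starts with the arc (c , x), ends with the arc (y , z),
    -- and whose vertices from x up to y lie in P.
    data Path (P : Pred V 0ℓ) (c x : V) : V → V → Set where
      []  : Path P c x c x
      _▷_ : ∀ {y z w} → Path P c x y z → z ∈ P × Induced y z w → Path P c x z w

    Path-mono : ∀ {P Q c x y z} → P ⊆ Q → Path P c x y z → Path Q c x y z
    Path-mono P⊆Q []               = []
    Path-mono P⊆Q (p ▷ (z∈P , i)) = Path-mono P⊆Q p ▷ (P⊆Q z∈P , i)

    -- Chordlessness concerns three consecutive vertices, so paths overlapping in a whole arc glue
    -- without any new triple.
    _++_ : ∀ {P c x y z u v} → Path P c x y z → Path P y z u v → Path P c x u v
    p ++ []      = p
    p ++ (q ▷ s) = (p ++ q) ▷ s

    penultimate : ∀ {P c x y z} → c ∈ P → Path P c x y z → y ∈ P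
    penultimate c∈P []             = c∈P
    penultimate _   (_ ▷ (z∈P , _)) = z∈P

    Branch : Pred V 0ℓ → Pred V 0ℓ → V → V → Set
    Branch P Q c x = ∃₂ λ y z → z ∈ Q × Path P c x y z

    -- The path is cut at the first vertex that `split` places in `Q`; all earlier ones were placed
    -- in `C`.
    truncate : ∀ {P Q C c x} → P ⊆ Q ∪ C → Branch P Q c x → Branch C Q c x
    truncate {P} {Q} {C} {c} {x} split (y , z , z∈Q , p) =
      [ id , (λ p′ → y , z , z∈Q , p′) ]′ (go p)
      where
      go : ∀ {y z} → Path P c x y z → Branch C Q c x ⊎ Path C c x y z
      go [] = inj₂ []
      go (p ▷ (z∈P , i)) with go p
      ... | inj₁ b = inj₁ b
      ... | inj₂ p′ with split z∈P
      ...   | inj₁ z∈Q = inj₁ (_ , _ , z∈Q , p′)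
      ...   | inj₂ z∈C = inj₂ (p′ ▷ (z∈C , i))

    -- A chordless walk given by its two halves issuing from an interior vertex.
    record Crossing (P Q : Pred V 0ℓ) : Set where
      constructor crossing
      field
        {centre l r} : V
        centre∈P     : centre ∈ P
        bend         : Induced l centre r
        left         : Branch P Q centre l
        right        : Branch P Q centre r

    open Crossing

    -- Crossings as walks

    data Seq (e : V) : V → V → Set where
      [_] : ∀ a → Seq e a e
      _∷_ : ∀ {a b c} → Induced a b c → Seq e b c → Seq e a b

    cons : V → Walk V → Walk V
    cons a (walk n f) = walk (suc n) λ { zero → a ; (suc i) → f i }

    toWalk : ∀ {e a b} → Seq e a b → Walk V
    toWalk {e} [ a ]      = walk 0 λ { zero → a ; (suc _) → e }
    toWalk (_∷_ {a} _ s) = cons a (toWalk s)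

    open Walk

    private
      first : ∀ {e a b} (s : Seq e a b) → vertex (toWalk s) zero ≡ a
      first [ _ ]   = refl
      first (_ ∷ _) = refl

      second : ∀ {e a b} (s : Seq e a b) → vertex (toWalk s) (suc zero) ≡ b
      second [ _ ]   = refl
      second (_ ∷ s) = first s

    toWalk-chordless : ∀ {e a b} (s : Seq e a b) → WeightedChordless A (toWalk s)
    toWalk-chordless ((_ , lt) ∷ s) zero rewrite first s | second s = lt
    toWalk-chordless (_ ∷ s) (suc j) = toWalk-chordless s j

    second∈interior : ∀ {e a b c} (i : Induced a b c) (s : Seq e b c) → b ∈ interior (toWalk (i ∷ s))
    second∈interior i s = zero , first s

    interior-∷ : ∀ {e a b c} (i : Induced a b c) (s : Seq e b c) →
                 interior (toWalk s) ⊆ interior (toWalk (i ∷ s))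
    interior-∷ i s (j , eq) = suc j , eq

    vertices⊆ : ∀ {e a b} (s : Seq e a b) {v} → v ∈ vertices (toWalk s) →
                v ≡ a ⊎ v ≡ e ⊎ v ∈ interior (toWalk s)
    vertices⊆ [ _ ] (zero , eq)      = inj₁ (sym eq)
    vertices⊆ [ _ ] (suc zero , eq)  = inj₂ (inj₁ (sym eq))
    vertices⊆ (i ∷ s) (zero , eq)    = inj₁ (sym eq)
    vertices⊆ (i ∷ s) (suc k , eq) with vertices⊆ s (k , eq)
    ... | inj₁ refl        = inj₂ (inj₂ (second∈interior i s))
    ... | inj₂ (inj₁ v≡e)  = inj₂ (inj₁ v≡e)
    ... | inj₂ (inj₂ v∈)   = inj₂ (inj₂ (interior-∷ i s v∈))

    prepend : ∀ {P c x y z e} → Path P c x y z → Seq e y z → Seq e c x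
    prepend []            s = s
    prepend (p ▷ (_ , i)) s = prepend p (i ∷ s)

    prependReversed : ∀ {P c x y z e} → Path P c x y z → (s : Seq e x c) →
                      ∃ λ (s′ : Seq e z y) → interior (toWalk s) ⊆ interior (toWalk s′)
    prependReversed []            s = s , id
    prependReversed (p ▷ (_ , i)) s with prependReversed p s
    ... | s′ , sub = Induced-sym i ∷ s′ , λ v∈ → interior-∷ (Induced-sym i) s′ (sub v∈)

    realise : ∀ {P Q} (X : Crossing P Q) → ∃ λ W → WeightedChordless A W ×
              centre X ∈ interior W × (∀ {v} → v ∈ vertices W → v ∈ Q ⊎ v ∈ interior W)
    realise {Q = Q} (crossing {c} {l} _ i (_ , e , e∈Q , p) (_ , e′ , e′∈Q , p′))
      -- The left half backwards, then the bend, then the right half.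
      with prependReversed p (i ∷ prepend p′ [ _ ])
    ... | s , sub = toWalk s , toWalk-chordless s , sub (second∈interior i (prepend p′ [ _ ])) , ends
      where
      ends : ∀ {v} → v ∈ vertices (toWalk s) → v ∈ Q ⊎ v ∈ interior (toWalk s)
      ends v∈ with vertices⊆ s v∈
      ... | inj₁ refl        = inj₁ e∈Q
      ... | inj₂ (inj₁ refl) = inj₁ e′∈Q
      ... | inj₂ (inj₂ v∈I)  = inj₂ v∈I

    interior⊆vertices : ∀ (W : Walk V) → interior W ⊆ vertices W
    interior⊆vertices W (j , eq) = suc (inject₁ j) , eq

    -- A centre is interior to its own walk, so an end lying at the other walk's centre is covered
    -- by that walk's interior.
    crossings⇒selfContained : ∀ {P P′ Q Q′} (X : Crossing P Q) (Y : Crossing P′ Q′) →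
      (∀ {v} → v ∈ Q → v ≡ centre Y) → (∀ {v} → v ∈ Q′ → v ≡ centre X) →
      HasSelfContainedPair A
    crossings⇒selfContained X Y Q⊆ Q′⊆ with realise X | realise Y
    ... | W , chordless , x∈W , ends | W′ , chordless′ , y∈W′ , ends′ =
      W , W′ , chordless , chordless′ ,
      [ (λ v∈ → [ (λ v∈Q → inj₂ (subst (_∈ interior W′) (sym (Q⊆ v∈Q)) y∈W′)) , inj₁ ]′ (ends v∈))
      , (λ v∈ → [ (λ v∈Q → inj₁ (subst (_∈ interior W) (sym (Q′⊆ v∈Q)) x∈W)) , inj₂ ]′ (ends′ v∈)) ]′ ,
      [ inj₁ ∘ interior⊆vertices W , inj₂ ∘ interior⊆vertices W′ ]′

    Boundary : Pred V 0ℓ → Pred V 0ℓ → Pred V 0ℓ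
    Boundary K C v = v ∈ K × v ∉ C

    -- The threshold graph

    module Threshold (K : Pred V 0ℓ) (p q : V)
      (minimal : ∀ {x y} → x ∈ K → y ∈ K → x ≢ y → ¬ A x y < A p q) where

      Adj : V → V → Set
      Adj x y = A p q < A x y

      Adj-sym : ∀ {x y} → Adj x y → Adj y x
      Adj-sym {x} {y} = <-respʳ-≃ (A p q) (A x y) (A y x) (A-sym x y)

      Apart : V → V → Set
      Apart x y = x ≢ y × ¬ Adj x y

      -- Both arcs exceed the threshold, so by cotransitivity `A x z` exceeds it too, which is
      -- excluded, or lies below both arcs.
      induced : ∀ {x y z} → Adj x y → Adj y z → Apart x z → Induced x y z
      induced {x} {y} {z} xy yz (x≢z , ¬xz)
        with <-cotrans (A p q) (A x z) (A x y ⊓ A z y) (<-⊓ (A p q) (A x y) (A z y) xy (Adj-sym yz))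
      ... | inj₁ xz = contradiction xz ¬xz
      ... | inj₂ lt = x≢z , lt

      -- By minimality the chord is at least the threshold, so an arc beating the chord is an edge
      -- of G.
      induced⇒Adj : ∀ {x y z} → x ∈ K → z ∈ K → Induced x y z → Adj x y
      induced⇒Adj {x} {y} {z} x∈K z∈K (x≢z , r , u , l , _)
        with <-cotrans (A x z) (A p q) (A x y) (r , u , l)
      ... | inj₁ lt = contradiction lt (minimal x∈K z∈K x≢z)
      ... | inj₂ xy = xy

      start∈ : ∀ {P c x y z} → Path P c x y z → P ⊆ K → z ∈ K → x ∈ K
      start∈ []             P⊆K z∈K = z∈K
      start∈ (p ▷ (z∈P , _)) P⊆K _   = start∈ p P⊆K (P⊆K z∈P)

      -- The last triple makes the final arc an edge; a single arc has no triple, hence the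
      -- hypothesis on `(c , x)`.
      lastArc-Adj : ∀ {P c x y z} → Path P c x y z → P ⊆ K → c ∈ P → z ∈ K → Adj c x → Adj y z
      lastArc-Adj []            P⊆K c∈P z∈K cx = cx
      lastArc-Adj (p ▷ (_ , i)) P⊆K c∈P w∈K _  =
        Adj-sym (induced⇒Adj w∈K (P⊆K (penultimate c∈P p)) (Induced-sym i))

      -- Components and separators

      Component : Pred V 0ℓ → V → Pred V 0ℓ
      Component R x = Star (λ a b → Adj a b × a ∈ R × b ∈ R) x

      -- A full component of the separator `Z`: a component of G - Z in which every vertex of `Z`
      -- has a neighbour.
      record Side (Z S : Pred V 0ℓ) : Set where
        field
          inside    : S ⊆ K
          elem      : V
          elem∈     : elem ∈ S
          avoids    : ∀ {x} → x ∈ S → x ∉ Z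
          neighbour : ∀ {x y} → x ∈ S → y ∈ K → Adj x y → y ∈ S ⊎ y ∈ Z
          attached  : ∀ {t} → t ∈ Z → ∃ λ x → x ∈ S × Adj t x
          connected : ∀ {x y} → x ∈ S → y ∈ S → y ∈ Component S x

      component⊆ : ∀ {R x} → x ∈ R → Component R x ⊆ R
      component⊆ x∈R ε                   = x∈R
      component⊆ x∈R ((_ , _ , b∈R) ◅ s) = component⊆ b∈R s

      component-connected : ∀ {R x u v} → u ∈ Component R x → v ∈ Component R x →
                            v ∈ Component (Component R x) u
      component-connected {R} {x} xu xv =
        Star.reverse (λ (ab , a∈ , b∈) → Adj-sym ab , b∈ , a∈) (lift ε xu) ◅◅ lift ε xv
        where
        lift : ∀ {a b} → a ∈ Component R x → b ∈ Component R a →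
               b ∈ Component (Component R x) a
        lift xa ε        = ε
        lift xa (ab ◅ s) = (proj₁ ab , xa , xa ◅◅ ab ◅ ε) ◅ lift (xa ◅◅ ab ◅ ε) s

      -- Only vertices at distance two along the path need to be apart.
      data InducedPath (d t : V) : V → V → Set where
        []  : Adj d t → InducedPath d t d t
        _▷_ : ∀ {y z w} → InducedPath d t y z → z ∈ K × Adj z w × Apart y w → InducedPath d t z w

      lastAdj : ∀ {d t y z} → InducedPath d t y z → Adj y z
      lastAdj ([] dt)            = dt
      lastAdj (_ ▷ (_ , zw , _)) = zw

      toPath : ∀ {d t y z} → InducedPath d t y z → Path K d t y z
      toPath ([] _)               = []
      toPath (g ▷ (z∈K , zw , ap)) = toPath g ▷ (z∈K , induced (lastAdj g) zw ap)

      -- If w is already adjacent or equal to an earlier vertex, the path is shortcut there;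
      -- since d is apart from w, the initial arc (d , t) always survives.
      extend : ∀ {d t y z w} → InducedPath d t y z → z ∈ K → Adj z w → Apart d w →
               ∃ λ y′ → InducedPath d t y′ w
      extend g@([] _) z∈K zw dw = _ , g ▷ (z∈K , zw , dw)
      extend {y = y} {w = w} g@(g′ ▷ (y∈K , _ , _)) z∈K zw dw with em {y ≡ w} | em {Adj y w}
      ... | yes refl | _      = _ , g′
      ... | no _     | yes yw = extend g′ y∈K yw dw
      ... | no y≢w   | no ¬yw = _ , g ▷ (z∈K , zw , y≢w , ¬yw)

      along : ∀ {d t y z w} {S : Pred V 0ℓ} → S ⊆ K → (∀ {x} → x ∈ S → Apart d x) →
              z ∈ K → InducedPath d t y z → w ∈ Component S z → ∃ λ y′ → InducedPath d t y′ w
      along S⊆K apart z∈K g ε = _ , g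
      along S⊆K apart z∈K g ((zb , _ , b∈S) ◅ s) =
        along S⊆K apart (S⊆K b∈S) (proj₂ (extend g z∈K zb (apart b∈S))) s

      -- Prolonging across the separator

      module TwoSides {Z S S′ : Pred V 0ℓ} (side : Side Z S) (side′ : Side Z S′)
        (Z⊆K : Z ⊆ K) (S⊥S′ : ∀ {x} → x ∈ S → x ∉ S′) (C : Pred V 0ℓ)
        (ih : Crossing (S ∩ C) (Boundary (S ∪ Z) (S ∩ C))) where

        private
          module L = Side side
          module R = Side side′

        apart : ∀ {x y} → x ∈ S → y ∈ S′ → Apart x y
        apart x∈S y∈S′ = (λ { refl → S⊥S′ x∈S y∈S′ }) ,
          λ xy → [ (λ y∈S → S⊥S′ y∈S y∈S′) , R.avoids y∈S′ ]′
                   (L.neighbour x∈S (R.inside y∈S′) xy)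

        -- All of `S′` is apart from `d`, so shortcuts never remove the arc `(d , t)`, along which
        -- the result is glued to a branch.
        cross : ∀ {d t w} → d ∈ S → t ∈ Z → Adj d t → w ∈ S′ → ∃ λ y → Path K d t y w
        cross d∈S t∈Z dt w∈S′ with R.attached t∈Z
        ... | x , x∈S′ , tx with extend ([] dt) (Z⊆K t∈Z) tx (apart d∈S x∈S′)
        ...   | _ , g with along R.inside (apart d∈S) (R.inside x∈S′) g (R.connected x∈S′ w∈S′)
        ...     | y , g′ = y , toPath g′

        Ends : V → Pred V 0ℓ
        Ends w v = (v ∈ S × v ∉ C) ⊎ v ≡ w

        -- A branch ending in `S` outside `C` is kept; one ending in `Z` arrives there by an edge of
        -- G and is prolonged to `w`.
        crossing-to : ∀ {w} → w ∈ S′ → ∃ λ (X : Crossing K (Ends w)) → centre X ≡ centre ih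
        crossing-to {w} w∈S′ =
          crossing (L.inside (proj₁ (centre∈P ih))) (bend ih)
            (reach (left ih) (induced⇒Adj l∈K r∈K (bend ih)))
            (reach (right ih) (induced⇒Adj r∈K l∈K (Induced-sym (bend ih)))) , refl
          where
          S∩C⊆K : S ∩ C ⊆ K
          S∩C⊆K = L.inside ∘ proj₁

          S∪Z⊆K : S ∪ Z ⊆ K
          S∪Z⊆K = [ L.inside , Z⊆K ]′

          start∈K : ∀ {x} → Branch (S ∩ C) (Boundary (S ∪ Z) (S ∩ C)) (centre ih) x → x ∈ K
          start∈K (_ , _ , (z∈ , _) , p) = start∈ p S∩C⊆K (S∪Z⊆K z∈)

          l∈K = start∈K (left ih)
          r∈K = start∈K (right ih)

          reach : ∀ {x} → Branch (S ∩ C) (Boundary (S ∪ Z) (S ∩ C)) (centre ih) x →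
                  Adj x (centre ih) → Branch K (Ends w) (centre ih) x
          reach (y , z , (inj₁ z∈S , z∉) , p) _ =
            y , z , inj₁ (z∈S , λ z∈C → z∉ (z∈S , z∈C)) , Path-mono S∩C⊆K p
          reach (y , z , (inj₂ z∈Z , _) , p) xc
            with cross (proj₁ (penultimate (centre∈P ih) p)) z∈Z
                       (lastArc-Adj p S∩C⊆K (centre∈P ih) (Z⊆K z∈Z) (Adj-sym xc)) w∈S′
          ... | y′ , p′ = y′ , w , inj₂ refl , Path-mono S∩C⊆K p ++ p′

        -- Now every possible end avoids `C`, so both halves can be truncated on first leaving `C`.
        crossing-out : ∀ {w} → w ∈ S′ → w ∉ C → Crossing C (Boundary K C)
        crossing-out {w} w∈S′ w∉C with crossing-to w∈S′
        ... | crossing _ i lb rb , refl = crossing (proj₂ (centre∈P ih)) i (cut lb) (cut rb)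
          where
          split : K ⊆ Boundary K C ∪ C
          split {v} v∈K with em {v ∈ C}
          ... | yes v∈C = inj₂ v∈C
          ... | no v∉C  = inj₁ (v∈K , v∉C)

          cut : ∀ {c x} → Branch K (Ends w) c x → Branch C (Boundary K C) c x
          cut (y , z , inj₁ (z∈S , z∉C) , p) = truncate split (y , z , (L.inside z∈S , z∉C) , p)
          cut (y , z , inj₂ refl , p)        = truncate split (y , z , (R.inside w∈S′ , w∉C) , p)

      crossing-sides : ∀ {Z S S′} → Side Z S → Side Z S′ → Z ⊆ K → (∀ {x} → x ∈ S → x ∉ S′) →
        ∀ {C c} → c ∈ C → c ∈ S → ¬ HasSelfContainedPair A →
        (∀ {S S′} → Side Z S → Side Z S′ → (∀ {x} → x ∈ S → x ∉ S′) → ∀ {c} → c ∈ S → c ∈ C →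
           Crossing (S ∩ C) (Boundary (S ∪ Z) (S ∩ C))) →
        Crossing C (Boundary K C)
      crossing-sides {Z} {S} {S′} side side′ Z⊆K S⊥S′ {C} c∈C c∈S no-pair ih =
        conclude (em {∃ λ w → w ∈ S′ × w ∉ C}) (em {∃ λ w → w ∈ S × w ∉ C})
        where
        S′⊥S : ∀ {x} → x ∈ S′ → x ∉ S
        S′⊥S x∈S′ x∈S = S⊥S′ x∈S x∈S′

        ih₀ = ih side side′ S⊥S′ c∈S c∈C

        module F = TwoSides side side′ Z⊆K S⊥S′ C ih₀

        conclude : Dec (∃ λ w → w ∈ S′ × w ∉ C) → Dec (∃ λ w → w ∈ S × w ∉ C) →
                   Crossing C (Boundary K C)
        conclude (yes (_ , w∈S′ , w∉C)) _ = F.crossing-out w∈S′ w∉C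
        conclude (no S′⊆C) dec = conclude′ dec
          where
          -- Here `S′` lies in `C`, so it meets `C` and induction applies to this side too.
          elem∈C : Side.elem side′ ∈ C
          elem∈C = decidable-stable em λ ∉C → S′⊆C (_ , Side.elem∈ side′ , ∉C)

          ih′ = ih side′ side S′⊥S (Side.elem∈ side′) elem∈C

          module B = TwoSides side′ side Z⊆K S′⊥S C ih′

          conclude′ : Dec (∃ λ w → w ∈ S × w ∉ C) → Crossing C (Boundary K C)
          conclude′ (yes (_ , w∈S , w∉C)) = B.crossing-out w∈S w∉C
          conclude′ (no S⊆C) =
            -- Each crossing is aimed at the other's centre; as `S` and `S′` lie in `C`, no other
            -- ends remain.
            let X , X≡ = F.crossing-to (proj₁ (centre∈P ih′))
                Y , Y≡ = B.crossing-to (proj₁ (centre∈P ih₀))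
            in contradiction
                 (crossings⇒selfContained X Y
                   [ (λ (v∈S , v∉C) → contradiction (_ , v∈S , v∉C) S⊆C)
                   , (λ v≡ → trans v≡ (sym Y≡)) ]′
                   [ (λ (v∈S′ , v∉C) → contradiction (_ , v∈S′ , v∉C) S′⊆C)
                   , (λ v≡ → trans v≡ (sym X≡)) ]′)
                 no-pair

    -- Induction on the vertex set

    module _ (no-pair : ¬ HasSelfContainedPair A) where

      -- The length of a list `xs` covering `K` stands in for |K|, and `n` bounds it strictly for
      -- structural recursion.
      escape : ∀ n {K C : Pred V 0ℓ} (xs : List V) → length xs ℕ.< n → (∀ {v} → v ∈ K → v ∈ˡ xs) →
               C ⊆ K → (∀ {v} → v ∈ C → Obstructed K v) → ∀ {c} → c ∈ C →
               Crossing C (Boundary K C)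
      escape (suc n) {K} {C} xs (s≤s xs≤n) K⊆xs C⊆K obstructed {c₀} c₀∈C =
        let x , z , x∈K , z∈K , x≢z , _ = obstructed c₀∈C
            (p , q) , (p∈K , q∈K , p≢q) , least-pq =
              least (λ (x , y) → A x y) {λ (x , y) → x ∈ K × y ∈ K × x ≢ y}
                (cartesianProduct xs xs)
                (lose (∈-cartesianProduct⁺ (K⊆xs x∈K) (K⊆xs z∈K)) (x∈K , z∈K , x≢z))
        in at-threshold p q p∈K q∈K p≢q λ x∈K y∈K x≢y →
             All.lookup least-pq (∈-cartesianProduct⁺ (K⊆xs x∈K) (K⊆xs y∈K)) (x∈K , y∈K , x≢y)
        where
        at-threshold : ∀ p q → p ∈ K → q ∈ K → p ≢ q →
          (∀ {x y} → x ∈ K → y ∈ K → x ≢ y → ¬ A x y < A p q) → Crossing C (Boundary K C)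
        at-threshold p q p∈K q∈K p≢q minimal =
          by-universality (em {∃₂ λ c x → c ∈ C × x ∈ K × Apart c x})
          where
          open Threshold K p q minimal

          by-universality : Dec (∃₂ λ c x → c ∈ C × x ∈ K × Apart c x) →
                            Crossing C (Boundary K C)
          by-universality (no universal) =
            crossing c₀∈C
              (induced (Adj-sym (near c₀∈C p∈K λ { refl → p∉C c₀∈C }))
                       (near c₀∈C q∈K λ { refl → q∉C c₀∈C }) (p≢q , pq-apart))
              (_ , p , (p∈K , p∉C) , []) (_ , q , (q∈K , q∉C) , [])
            where
            near : ∀ {c x} → c ∈ C → x ∈ K → c ≢ x → Adj c x
            near c∈C x∈K c≢x =
              decidable-stable em λ ¬cx → universal (_ , _ , c∈C , x∈K , c≢x , ¬cx)

            pq-apart : ¬ Adj p q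
            pq-apart = <-irrefl (A p q)

            -- A vertex of `C` is adjacent to every other vertex of `K`, whereas `p` and `q` are not
            -- adjacent.
            p∉C : p ∉ C
            p∉C p∈C = pq-apart (near p∈C q∈K p≢q)

            q∉C : q ∉ C
            q∉C q∈C = pq-apart (Adj-sym (near q∈C p∈K (≢-sym p≢q)))
          by-universality (yes (c , x , c∈C , x∈K , c#x)) =
            crossing-sides side-c side-x Z⊆K c-side-avoids-H c∈C ε no-pair
              λ {S} {S′} → recurse {S} {S′}
            where
            Far H Z Rest : Pred V 0ℓ
            -- H is a component of G − N[c] and Z = N(H), so Z ⊆ N(c).
            Far y  = y ∈ K × Apart c y
            H      = Component Far x
            Z y    = y ∈ K × y ∉ H × ∃ λ h → h ∈ H × Adj y h
            Rest y = y ∈ K × y ∉ Z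

            x∈Far : x ∈ Far
            x∈Far = x∈K , c#x

            H⊆Far : H ⊆ Far
            H⊆Far = component⊆ x∈Far

            c∉H : c ∉ H
            c∉H c∈H = proj₁ (proj₂ (H⊆Far c∈H)) refl

            Z⊆K : Z ⊆ K
            Z⊆K = proj₁

            -- Otherwise `t` would lie in `Far` next to `H`, hence in `H`; and `t` is not `c`, since
            -- `c` has no neighbour in `H`.
            Z-near-c : ∀ {t} → t ∈ Z → Adj c t
            Z-near-c {t} (t∈K , t∉H , h , h∈H , th) = decidable-stable em λ ¬ct →
              t∉H (h∈H ◅◅ (Adj-sym th , H⊆Far h∈H , t∈K ,
                (λ { refl → proj₂ (proj₂ (H⊆Far h∈H)) th }) , ¬ct) ◅ ε)

            c∈Rest : c ∈ Rest
            c∈Rest = C⊆K c∈C , λ (_ , _ , _ , h∈H , ch) → proj₂ (proj₂ (H⊆Far h∈H)) ch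

            side-x : Side Z H
            side-x = record
              { inside    = proj₁ ∘ H⊆Far
              ; elem      = x
              ; elem∈     = ε
              ; avoids    = λ x∈H x∈Z → proj₁ (proj₂ x∈Z) x∈H
              ; neighbour = neighbour
              ; attached  = λ (_ , _ , h) → h
              ; connected = component-connected
              }
              where
              neighbour : ∀ {u y} → u ∈ H → y ∈ K → Adj u y → y ∈ H ⊎ y ∈ Z
              neighbour {u} {y} u∈H y∈K uy with em {y ∈ H}
              ... | yes y∈H = inj₁ y∈H
              ... | no y∉H  = inj₂ (y∈K , y∉H , u , u∈H , Adj-sym uy)

            side-c : Side Z (Component Rest c)
            side-c = record
              { inside    = proj₁ ∘ component⊆ c∈Rest
              ; elem      = c
              ; elem∈     = ε
              ; avoids    = proj₂ ∘ component⊆ c∈Rest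
              ; neighbour = neighbour
              ; attached  = λ t∈Z → c , ε , Adj-sym (Z-near-c t∈Z)
              ; connected = component-connected
              }
              where
              neighbour : ∀ {u y} → u ∈ Component Rest c → y ∈ K → Adj u y →
                          y ∈ Component Rest c ⊎ y ∈ Z
              neighbour {u} {y} cu y∈K uy with em {y ∈ Z}
              ... | yes y∈Z = inj₂ y∈Z
              ... | no y∉Z  = inj₁ (cu ◅◅ (uy , component⊆ c∈Rest cu , y∈K , y∉Z) ◅ ε)

            -- The last vertex before entering `H` would lie in `Z`, which `Rest` excludes.
            c-side-avoids-H : ∀ {y} → y ∈ Component Rest c → y ∉ H
            c-side-avoids-H = go c∉H
              where
              go : ∀ {a y} → a ∉ H → y ∈ Component Rest a → y ∉ H
              go a∉H ε = a∉H
              go a∉H ((ab , (a∈K , a∉Z) , _) ◅ s) = go (λ b∈H → a∉Z (a∈K , a∉H , _ , b∈H , ab)) s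

            recurse : ∀ {S S′} → Side Z S → Side Z S′ → (∀ {x} → x ∈ S → x ∉ S′) →
                      ∀ {c} → c ∈ S → c ∈ C →
                      Crossing (S ∩ C) (Boundary (S ∪ Z) (S ∩ C))
            recurse {S} {S′} side side′ S⊥S′ c∈S c∈C =
              escape n (filter S∪Z? xs)
                -- The chosen element of `S′` is filtered out, so the list gets shorter.
                (ℕ.≤-trans (filter-notAll S∪Z? xs (lose (K⊆xs (R.inside R.elem∈)) elem∉)) xs≤n)
                (λ v∈ → ∈-filter⁺ S∪Z? (K⊆xs ([ L.inside , Z⊆K ]′ v∈)) v∈)
                (inj₁ ∘ proj₁) obstructed′ (c∈S , c∈C)
              where
              module L = Side side
              module R = Side side′

              S∪Z? : ∀ v → Dec (v ∈ S ∪ Z)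
              S∪Z? _ = em

              elem∉ : R.elem ∉ S ∪ Z
              elem∉ = [ (λ e∈S → S⊥S′ e∈S R.elem∈) , R.avoids R.elem∈ ]′

              -- Both ends of an obstruction at `v` are neighbours of `v` in G, so they stay in
              -- `S ∪ Z`.
              obstructed′ : ∀ {v} → v ∈ S ∩ C → Obstructed (S ∪ Z) v
              obstructed′ (v∈S , v∈C) with obstructed v∈C
              ... | y , z , y∈K , z∈K , i =
                y , z ,
                L.neighbour v∈S y∈K (Adj-sym (induced⇒Adj y∈K z∈K i)) ,
                L.neighbour v∈S z∈K (Adj-sym (induced⇒Adj z∈K y∈K (Induced-sym i))) , i

    -- Existence of a simplicial vertex

    ¬simplicial⇒obstructed : ∀ {v} → ¬ Simplicial A v → Obstructed U v
    ¬simplicial⇒obstructed {v} ¬simp = decidable-stable em λ none → ¬simp λ y z _ _ y≢z →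
      decidable-stable em λ ≰ → none (y , z , tt , tt , y≢z ,
        let q , u , l , l′ = ≰⇒> (A v y ⊓ A v z) (A y z) ≰
        in q , u , proj₁ (proj₁ (A-sym v y)) l , proj₁ (proj₁ (A-sym v z)) l′)

theorem3 : ExcludedMiddle 0ℓ →
    (V : Set) (n : ℕ) → V ↔ Fin n → V →
    (A : Matrix V) → Symmetric A →
    ¬ HasSelfContainedPair A →
    ∃ λ v → Simplicial A v
theorem3 em V n V↔Fin v A A-sym no-pair = decidable-stable em λ none →
  let X = Classical.escape em A A-sym no-pair (suc (length all)) {U} {U} all ℕ.≤-refl v∈all id
            (λ {w} _ → Classical.¬simplicial⇒obstructed em A A-sym λ simp → none (w , simp)) {v} tt
      _ , _ , (_ , ∉U) , _ = Classical.Crossing.left X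
  in ∉U tt
  where
  open Inverse V↔Fin

  all : List V
  all = map from (allFin n)

  v∈all : ∀ {w} → w ∈ U → w ∈ˡ all
  v∈all {w} _ = subst (_∈ˡ all) (strictlyInverseʳ w) (∈-map⁺ from (∈-allFin (to w)))
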